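{- Let $t\ge 3$ be an integer and let $G=(A\cup B,E)$ be a bipartite graph with bipartition $(A,B)$. Let $\mathcal{F}$ be the collection of all edge sets $F\subseteq E$ such that the subgraph $(A\cup B,F)$ has no $K_{1,t}$ with center vertex in $A$ (i.e. no vertex of $A$ has degree larger than $t-1$ in $(A\cup B,F)$). Then $M_t=(E,\mathcal{F})$ is a matroid with $\mathcal{F}$ as its family of independent sets.
   Context: Graphs are finite and simple. The center of $K_{1,t}$ is its vertex of degree $t$. -}

module Defs where

open import Data.Fin using (Fin)
open import Data.Fin.Subset
  using (Subset; _∈_; _∉_; _⊆_; _∩_; _∪_; ⁅_⁆; ∣_∣; ⊥; ⊤; Empty; Nonempty)
open import Data.Nat using (ℕ; _<_)
open import Data.Product using (∃-syntax; _×_)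
open import Data.Vec using (lookup; tabulate)
open import Function.Definitions using (Injective)
open import Level using (Level)
open import Relation.Binary.PropositionalEquality using (_≡_)
open import Relation.Nullary using (¬_)

-- A matroid on the ground set Fin m, given by its independent sets.
record IsMatroid {ℓ : Level} {m : ℕ} (Independent : Subset m → Set ℓ) : Set ℓ where
  field
    ∅-independent : Independent ⊥
    hereditary    : ∀ {I J} → J ⊆ I → Independent I → Independent J
    augmentation  : ∀ {I J} → Independent I → Independent J → ∣ I ∣ < ∣ J ∣ →
                    ∃[ e ] (e ∈ J × e ∉ I × Independent (I ∪ ⁅ e ⁆))

-- A finite simple graph with vertex set Fin n whose m edges are enumerated
-- by Fin m.  An edge is a two-element set of vertices (no loops), and distinct
-- indices give distinct sets (no parallel edges), so that Subset m is the
-- collection of all edge sets F ⊆ E.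
record Graph (n m : ℕ) : Set where
  field
    ends           : Fin m → Subset n
    ends-size      : ∀ e → ∣ ends e ∣ ≡ 2
    ends-injective : Injective _≡_ _≡_ ends

record IsBipartition {n m : ℕ} (G : Graph n m) (A B : Subset n) : Set where
  open Graph G
  field
    disjoint : Empty (A ∩ B)
    covers   : A ∪ B ≡ ⊤
    meets-A  : ∀ e → Nonempty (ends e ∩ A)
    meets-B  : ∀ e → Nonempty (ends e ∩ B)

-- For F ⊆ E, the following notions refer to the spanning subgraph (V , F).
module _ {n m : ℕ} (G : Graph n m) (F : Subset m) where
  open Graph G

  Adjacent : Fin n → Fin n → Set
  Adjacent u v = ∃[ e ] (e ∈ F × ends e ≡ ⁅ u ⁆ ∪ ⁅ v ⁆)

  degree : Fin n → ℕ
  degree v = ∣ F ∩ tabulate (λ e → lookup (ends e) v) ∣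

  -- A (not necessarily induced) subgraph K_{1,t} with the given center.  The
  -- leaves differ from the center because there are no loops.
  record Star (t : ℕ) (center : Fin n) : Set where
    field
      leaf           : Fin t → Fin n
      leaf-injective : Injective _≡_ _≡_ leaf
      leaf-adjacent  : ∀ i → Adjacent center (leaf i)

-- The family of the edge sets F such that (V , F) has no K_{1,t} with center in A.
StarFree : {n m : ℕ} → Graph n m → Subset n → ℕ → Subset m → Set
StarFree G A t F = ∀ a → a ∈ A → ¬ Star G F t a

{-# OPTIONS --safe #-}

-- An edge has exactly one end in A, so the sets of edges at the vertices of A
-- partition E, and F is independent exactly when it has at most t - 1 edges in
-- each class: a partition matroid.  If |I| < |J| then some class contains fewer
-- edges of I than of J; any edge of J \ I in that class can be added to I.
module Submission where

open import Data.Bool using (Bool; true)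
open import Data.Fin using (Fin; zero; suc; inject≤; _≟_)
open import Data.Fin.Properties using (injective⇒≤; inject≤-injective) renaming (suc-injective to Fin-suc-injective)
open import Data.Fin.Subset using (Subset; _∈_; _∉_; _⊆_; _∩_; _∪_; ⁅_⁆; ∣_∣; ⊥; inside; outside)
open import Data.Fin.Subset.Properties
open import Data.Nat using (ℕ; zero; suc; _+_; _≤_; _<_; _∸_; s≤s; s<s⁻¹; _<?_)
open import Data.Nat.Properties
  using (+-0-commutativeMonoid; ≤-refl; ≤-reflexive; ≤-trans; <⇒≱; ≮⇒≥;
         +-mono-≤; m≤n⇒m≤1+n; suc-injective; module ≤-Reasoning)
open import Data.Product using (_×_; _,_; proj₁; proj₂; ∃-syntax)
open import Data.Sum using (inj₁; inj₂)
open import Data.Vec using ([]; _∷_; here; there; lookup; tabulate)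
open import Data.Vec.Properties using ([]=⇒lookup; lookup⇒[]=; lookup∘tabulate)
open import Function.Base using (_∘_)
open import Function.Bundles using (_⇔_; mk⇔; Equivalence)
open import Function.Definitions using (Injective)
open import Relation.Binary.PropositionalEquality
open import Relation.Nullary using (yes; no; does; contradiction)
open import Relation.Nullary.Decidable using (dec-true)
open import Defs
open import Algebra.Properties.CommutativeMonoid.Sum +-0-commutativeMonoid
  using (sum; ∑-distrib-+; sum-cong-≗; sum-replicate-zero)

private variable
  k m n : ℕ

-- Cardinalities of finite subsets

nth : (p : Subset n) → Fin ∣ p ∣ → Fin n
nth (inside  ∷ p) zero    = zero
nth (inside  ∷ p) (suc i) = suc (nth p i)
nth (outside ∷ p) i       = suc (nth p i)

nth-∈ : (p : Subset n) (i : Fin ∣ p ∣) → nth p i ∈ p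
nth-∈ (inside  ∷ p) zero    = here
nth-∈ (inside  ∷ p) (suc i) = there (nth-∈ p i)
nth-∈ (outside ∷ p) i       = there (nth-∈ p i)

nth-injective : (p : Subset n) → Injective _≡_ _≡_ (nth p)
nth-injective (inside  ∷ p) {zero}  {zero}  _  = refl
nth-injective (inside  ∷ p) {suc i} {suc j} eq = cong suc (nth-injective p (Fin-suc-injective eq))
nth-injective (outside ∷ p) eq = nth-injective p (Fin-suc-injective eq)

-- The position of `x` in the increasing enumeration of `p`, so inverse to `nth`.
rank : {p : Subset n} {x : Fin n} → x ∈ p → Fin ∣ p ∣
rank here = zero
rank {p = inside  ∷ _} (there x∈p) = suc (rank x∈p)
rank {p = outside ∷ _} (there x∈p) = rank x∈p

rank-injective : {p : Subset n} {x y : Fin n} (x∈p : x ∈ p) (y∈p : y ∈ p) →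
                 rank x∈p ≡ rank y∈p → x ≡ y
rank-injective here here _ = refl
rank-injective {p = inside  ∷ _} (there x∈p) (there y∈p) eq =
  cong suc (rank-injective x∈p y∈p (Fin-suc-injective eq))
rank-injective {p = outside ∷ _} (there x∈p) (there y∈p) eq =
  cong suc (rank-injective x∈p y∈p eq)

-- Following `f` by `rank` gives an injection `Fin k → Fin ∣ p ∣`, and the pigeonhole principle
-- applies.
injection⇒≤∣p∣ : {p : Subset n} {f : Fin k → Fin n} → Injective _≡_ _≡_ f →
                 (∀ i → f i ∈ p) → k ≤ ∣ p ∣
injection⇒≤∣p∣ f-inj f∈p =
  injective⇒≤ {f = λ i → rank (f∈p i)} (λ eq → f-inj (rank-injective (f∈p _) (f∈p _) eq))

∣p∣<∣q∣⇒∃∈q∉p : (p q : Subset n) → ∣ p ∣ < ∣ q ∣ → ∃[ x ] (x ∈ q × x ∉ p)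
∣p∣<∣q∣⇒∃∈q∉p (outside ∷ p) (inside ∷ q) _ = zero , here , λ ()
∣p∣<∣q∣⇒∃∈q∉p (inside ∷ p) (inside ∷ q) lt with ∣p∣<∣q∣⇒∃∈q∉p p q (s<s⁻¹ lt)
... | x , x∈q , x∉p = suc x , there x∈q , x∉p ∘ drop-there
-- Dropping a head that lies only in the smaller set widens the gap between the cardinalities.
∣p∣<∣q∣⇒∃∈q∉p (inside ∷ p) (outside ∷ q) lt with ∣p∣<∣q∣⇒∃∈q∉p p q (≤-trans (m≤n⇒m≤1+n ≤-refl) lt)
... | x , x∈q , x∉p = suc x , there x∈q , x∉p ∘ drop-there
∣p∣<∣q∣⇒∃∈q∉p (outside ∷ p) (outside ∷ q) lt with ∣p∣<∣q∣⇒∃∈q∉p p q lt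
... | x , x∈q , x∉p = suc x , there x∈q , x∉p ∘ drop-there

∣p∪⁅x⁆∣≤1+∣p∣ : (p : Subset n) (x : Fin n) → ∣ p ∪ ⁅ x ⁆ ∣ ≤ suc ∣ p ∣
∣p∪⁅x⁆∣≤1+∣p∣ (inside  ∷ p) zero    = s≤s (m≤n⇒m≤1+n (≤-reflexive (cong ∣_∣ (∪-identityʳ p))))
∣p∪⁅x⁆∣≤1+∣p∣ (outside ∷ p) zero    = s≤s (≤-reflexive (cong ∣_∣ (∪-identityʳ p)))
∣p∪⁅x⁆∣≤1+∣p∣ (inside  ∷ p) (suc x) = s≤s (∣p∪⁅x⁆∣≤1+∣p∣ p x)
∣p∪⁅x⁆∣≤1+∣p∣ (outside ∷ p) (suc x) = ∣p∪⁅x⁆∣≤1+∣p∣ p x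

∣p∣≡0⇒p≡⊥ : {p : Subset n} → ∣ p ∣ ≡ 0 → p ≡ ⊥
∣p∣≡0⇒p≡⊥ {p = []}          _  = refl
∣p∣≡0⇒p≡⊥ {p = outside ∷ p} eq = cong (outside ∷_) (∣p∣≡0⇒p≡⊥ eq)

∣p∣≡1⇒p≡⁅x⁆ : {p : Subset n} → ∣ p ∣ ≡ 1 → ∃[ x ] p ≡ ⁅ x ⁆
∣p∣≡1⇒p≡⁅x⁆ {p = inside  ∷ p} eq = zero , cong (inside ∷_) (∣p∣≡0⇒p≡⊥ (suc-injective eq))
∣p∣≡1⇒p≡⁅x⁆ {p = outside ∷ p} eq with ∣p∣≡1⇒p≡⁅x⁆ {p = p} eq
... | x , refl = suc x , refl

-- Used with `p` the ends of an edge at `x`: it produces the opposite end.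
∣p∣≡2⇒p≡⁅x⁆∪⁅y⁆ : {p : Subset n} {x : Fin n} → ∣ p ∣ ≡ 2 → x ∈ p → ∃[ y ] p ≡ ⁅ x ⁆ ∪ ⁅ y ⁆
∣p∣≡2⇒p≡⁅x⁆∪⁅y⁆ {p = inside ∷ p} eq here with ∣p∣≡1⇒p≡⁅x⁆ {p = p} (suc-injective eq)
... | y , refl = suc y , cong (inside ∷_) (sym (∪-identityˡ ⁅ y ⁆))
∣p∣≡2⇒p≡⁅x⁆∪⁅y⁆ {p = inside ∷ p} eq (there x∈p) with ∣p∣≡1⇒p≡⁅x⁆ {p = p} (suc-injective eq)
... | y , refl with refl ← x∈⁅y⁆⇒x≡y y x∈p = zero , cong (inside ∷_) (sym (∪-identityʳ ⁅ y ⁆))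
∣p∣≡2⇒p≡⁅x⁆∪⁅y⁆ {p = outside ∷ p} eq (there x∈p) with ∣p∣≡2⇒p≡⁅x⁆∪⁅y⁆ eq x∈p
... | y , refl = suc y , refl

x∈⁅y⁆∪⁅z⁆∧x≢y⇒x≡z : {x y z : Fin n} → x ∈ ⁅ y ⁆ ∪ ⁅ z ⁆ → x ≢ y → x ≡ z
x∈⁅y⁆∪⁅z⁆∧x≢y⇒x≡z {y = y} {z} x∈ x≢y with x∈p∪q⁻ ⁅ y ⁆ ⁅ z ⁆ x∈
... | inj₁ x∈⁅y⁆ = contradiction (x∈⁅y⁆⇒x≡y y x∈⁅y⁆) x≢y
... | inj₂ x∈⁅z⁆ = x∈⁅y⁆⇒x≡y z x∈⁅z⁆

-- Counting along the fibres of a map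

∈-tabulate⁺ : {f : Fin n → Bool} {x : Fin n} → f x ≡ true → x ∈ tabulate f
∈-tabulate⁺ {f = f} {x} eq = lookup⇒[]= x _ (trans (lookup∘tabulate f x) eq)

∈-tabulate⁻ : {f : Fin n → Bool} {x : Fin n} → x ∈ tabulate f → f x ≡ true
∈-tabulate⁻ {f = f} {x} x∈ = trans (sym (lookup∘tabulate f x)) ([]=⇒lookup x∈)

fibre : (Fin m → Fin n) → Fin n → Subset m
fibre f y = tabulate (λ x → does (f x ≟ y))

∈-fibre⁺ : {f : Fin m → Fin n} {x : Fin m} {y : Fin n} → f x ≡ y → x ∈ fibre f y
∈-fibre⁺ {f = f} {x} {y} eq = ∈-tabulate⁺ (dec-true (f x ≟ y) eq)

∈-fibre⁻ : {f : Fin m → Fin n} {x : Fin m} {y : Fin n} → x ∈ fibre f y → f x ≡ y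
∈-fibre⁻ {f = f} {x} {y} x∈ with f x ≟ y | ∈-tabulate⁻ {f = λ x → does (f x ≟ y)} x∈
... | yes eq | _ = eq

-- The summand is the Kronecker delta, written as the size of a one-bit subset because such a bit is
-- the head of `fibre f y`.
∑-δ≡1 : (x : Fin n) → sum (λ y → ∣ does (x ≟ y) ∷ [] ∣) ≡ 1
∑-δ≡1 {suc n} zero    = cong suc (sum-replicate-zero n)
∑-δ≡1 {suc n} (suc x) = ∑-δ≡1 x

∣s∷p∣≡∣s∷[]∣+∣p∣ : (s : Bool) (p : Subset n) → ∣ s ∷ p ∣ ≡ ∣ s ∷ [] ∣ + ∣ p ∣
∣s∷p∣≡∣s∷[]∣+∣p∣ inside  p = refl
∣s∷p∣≡∣s∷[]∣+∣p∣ outside p = refl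

-- Induction on `p`: a head that belongs to `p` adds one to the count over its image and nothing to
-- the other counts.
∣p∣≡∑∣p∩fibre∣ : (f : Fin m → Fin n) (p : Subset m) → ∣ p ∣ ≡ sum (λ y → ∣ p ∩ fibre f y ∣)
∣p∣≡∑∣p∩fibre∣ {n = n} f [] = sym (sum-replicate-zero n)
∣p∣≡∑∣p∩fibre∣ f (outside ∷ p) = ∣p∣≡∑∣p∩fibre∣ (f ∘ suc) p
∣p∣≡∑∣p∩fibre∣ {n = n} f (inside ∷ p) = begin
  1 + ∣ p ∣              ≡⟨ cong₂ _+_ (sym (∑-δ≡1 (f zero))) (∣p∣≡∑∣p∩fibre∣ (f ∘ suc) p) ⟩
  sum δ + sum c          ≡⟨ ∑-distrib-+ δ c ⟨
  -- `inside ∧ b` reduces to `b`, so the head bit of the intersection is the bit counted by `δ`.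
  sum (λ y → δ y + c y)  ≡⟨ sum-cong-≗ (λ y → ∣s∷p∣≡∣s∷[]∣+∣p∣ (does (f zero ≟ y)) (p ∩ fibre (f ∘ suc) y)) ⟨
  sum (λ y → ∣ (inside ∷ p) ∩ fibre f y ∣) ∎
  where
  open ≡-Reasoning
  δ c : Fin n → ℕ
  δ y = ∣ does (f zero ≟ y) ∷ [] ∣
  c y = ∣ p ∩ fibre (f ∘ suc) y ∣

-- If no term of `f` were below that of `g`, adding the reversed inequalities would contradict the
-- hypothesis.
∑<∑⇒∃< : (f g : Fin n → ℕ) → sum f < sum g → ∃[ i ] f i < g i
∑<∑⇒∃< {suc n} f g lt with f zero <? g zero
... | yes f₀<g₀ = zero , f₀<g₀
... | no  f₀≮g₀ with sum (f ∘ suc) <? sum (g ∘ suc)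
...   | yes lt′ = let i , fi<gi = ∑<∑⇒∃< (f ∘ suc) (g ∘ suc) lt′ in suc i , fi<gi
...   | no  ≮   = contradiction (+-mono-≤ (≮⇒≥ f₀≮g₀) (≮⇒≥ ≮)) (<⇒≱ lt)

∣p∣<∣q∣⇒∃fibre : (f : Fin m → Fin n) (p q : Subset m) → ∣ p ∣ < ∣ q ∣ →
                ∃[ y ] ∣ p ∩ fibre f y ∣ < ∣ q ∩ fibre f y ∣
∣p∣<∣q∣⇒∃fibre f p q lt =
  ∑<∑⇒∃< _ _ (subst₂ _<_ (∣p∣≡∑∣p∩fibre∣ f p) (∣p∣≡∑∣p∩fibre∣ f q) lt)

-- Stars and degrees

module _ {n m : ℕ} (G : Graph n m) where
  open Graph G

  incident : Fin n → Subset m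
  incident v = tabulate (λ e → lookup (ends e) v)

  ∈-incident⁺ : ∀ {e v} → v ∈ ends e → e ∈ incident v
  ∈-incident⁺ v∈e = ∈-tabulate⁺ ([]=⇒lookup v∈e)

  ∈-incident⁻ : ∀ {e v} → e ∈ incident v → v ∈ ends e
  ∈-incident⁻ {e} {v} e∈ = lookup⇒[]= v _ (∈-tabulate⁻ e∈)

  no-loops : ∀ {e u v} → ends e ≡ ⁅ u ⁆ ∪ ⁅ v ⁆ → u ≢ v
  no-loops {e} {u} eq refl
    with () ← trans (sym (ends-size e)) (trans (cong ∣_∣ (trans eq (∪-idem ⁅ u ⁆))) (∣⁅x⁆∣≡1 u))

  -- Each leaf is sent to its edge to the center. This is injective because an edge at `v`
  -- determines its other end.
  star⇒≤degree : ∀ {F t v} → Star G F t v → t ≤ degree G F v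
  star⇒≤degree {F} {t} {v} star = injection⇒≤∣p∣ edge-injective edge-∈
    where
    open Star star
    edge : Fin t → Fin m
    edge i = proj₁ (leaf-adjacent i)

    ends-edge : ∀ i → ends (edge i) ≡ ⁅ v ⁆ ∪ ⁅ leaf i ⁆
    ends-edge i = proj₂ (proj₂ (leaf-adjacent i))

    edge-injective : Injective _≡_ _≡_ edge
    edge-injective {i} {j} eq = leaf-injective
      (x∈⁅y⁆∪⁅z⁆∧x≢y⇒x≡z
        (subst (leaf i ∈_) (trans (sym (ends-edge i)) (trans (cong ends eq) (ends-edge j)))
          (q⊆p∪q ⁅ v ⁆ _ (x∈⁅x⁆ (leaf i))))
        (≢-sym (no-loops (ends-edge i))))

    edge-∈ : ∀ i → edge i ∈ F ∩ incident v
    edge-∈ i = x∈p∩q⁺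
      ( proj₁ (proj₂ (leaf-adjacent i))
      , ∈-incident⁺ (subst (v ∈_) (sym (ends-edge i)) (p⊆p∪q _ (x∈⁅x⁆ v))))

  -- The leaves are the far ends of the first `t` edges of `F` at `v`. They are distinct because
  -- there are no parallel edges.
  ≤degree⇒star : ∀ {F t v} → t ≤ degree G F v → Star G F t v
  ≤degree⇒star {F} {t} {v} t≤d = record
    { leaf           = λ i → proj₁ (other i)
    ; leaf-injective = λ {i} {j} eq →
        inject≤-injective t≤d t≤d i j (nth-injective S (ends-injective
          (trans (proj₂ (other i)) (trans (cong (λ w → ⁅ v ⁆ ∪ ⁅ w ⁆) eq) (sym (proj₂ (other j)))))))
    ; leaf-adjacent  = λ i → edge i , proj₁ (edge-∈ i) , proj₂ (other i)
    }
    where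
    S : Subset m
    S = F ∩ incident v

    edge : Fin t → Fin m
    edge i = nth S (inject≤ i t≤d)

    edge-∈ : ∀ i → edge i ∈ F × edge i ∈ incident v
    edge-∈ i = x∈p∩q⁻ F _ (nth-∈ S (inject≤ i t≤d))

    other : ∀ i → ∃[ w ] ends (edge i) ≡ ⁅ v ⁆ ∪ ⁅ w ⁆
    other i = ∣p∣≡2⇒p≡⁅x⁆∪⁅y⁆ (ends-size (edge i)) (∈-incident⁻ (proj₂ (edge-∈ i)))

  starFree⇔degree≤ : ∀ {A t F} → StarFree G A (suc t) F ⇔ (∀ a → a ∈ A → degree G F a ≤ t)
  starFree⇔degree≤ = mk⇔
    (λ free a a∈A → ≮⇒≥ (free a a∈A ∘ ≤degree⇒star))
    (λ bound a a∈A star → <⇒≱ (star⇒≤degree star) (bound a a∈A))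

  star-mono : ∀ {F F′ t v} → F ⊆ F′ → Star G F t v → Star G F′ t v
  star-mono F⊆F′ star = record
    { leaf           = leaf
    ; leaf-injective = leaf-injective
    ; leaf-adjacent  = λ i → let e , e∈F , eq = leaf-adjacent i in e , F⊆F′ e∈F , eq
    }
    where open Star star

  -- Bipartite graphs and the matroid axioms

  module _ {A B : Subset n} (bip : IsBipartition G A B) where
    open IsBipartition bip

    A-end : Fin m → Fin n
    A-end e = proj₁ (meets-A e)

    A-end-∈ : ∀ e → A-end e ∈ ends e × A-end e ∈ A
    A-end-∈ e = x∈p∩q⁻ (ends e) A (proj₂ (meets-A e))

    -- The edge has an end `b` in `B`, and every end in `A` differs from `b` by disjointness, hence
    -- equals the one remaining end `c`.
    A-end-unique : ∀ {e a} → a ∈ ends e → a ∈ A → A-end e ≡ a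
    A-end-unique {e} a∈e a∈A
      with b , b∈e∩B ← meets-B e
      with b∈e , b∈B ← x∈p∩q⁻ (ends e) B b∈e∩B
      with c , eq ← ∣p∣≡2⇒p≡⁅x⁆∪⁅y⁆ (ends-size e) b∈e
      = trans (isOther (proj₁ (A-end-∈ e)) (proj₂ (A-end-∈ e))) (sym (isOther a∈e a∈A))
      where
      isOther : ∀ {u} → u ∈ ends e → u ∈ A → u ≡ c
      isOther u∈e u∈A = x∈⁅y⁆∪⁅z⁆∧x≢y⇒x≡z (subst (_ ∈_) eq u∈e)
        λ { refl → disjoint (b , x∈p∩q⁺ (u∈A , b∈B)) }

    -- Turns degrees at vertices of `A` into fibre counts of `A-end`, to which the counting lemmas
    -- apply.
    incident≡fibre : ∀ {a} → a ∈ A → incident a ≡ fibre A-end a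
    incident≡fibre a∈A = ⊆-antisym
      (λ e∈ → ∈-fibre⁺ {f = A-end} (A-end-unique (∈-incident⁻ e∈) a∈A))
      (λ {e} e∈ → ∈-incident⁺ (subst (_∈ ends e) (∈-fibre⁻ {f = A-end} e∈) (proj₁ (A-end-∈ e))))

    degree-augmentation : ∀ {t I J} →
      (∀ a → a ∈ A → degree G I a ≤ t) → (∀ a → a ∈ A → degree G J a ≤ t) → ∣ I ∣ < ∣ J ∣ →
      ∃[ e ] (e ∈ J × e ∉ I × (∀ a → a ∈ A → degree G (I ∪ ⁅ e ⁆) a ≤ t))
    degree-augmentation {t} {I} {J} I≤t J≤t I<J
      with v , Iv<Jv ← ∣p∣<∣q∣⇒∃fibre A-end I J I<J
      with e , e∈Jv , e∉Iv ← ∣p∣<∣q∣⇒∃∈q∉p (I ∩ fibre A-end v) (J ∩ fibre A-end v) Iv<Jv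
      with e∈J , e∈v ← x∈p∩q⁻ J _ e∈Jv
      -- The class `v` found by counting is thereby identified with `A-end e`, a vertex of `A`.
      with refl ← ∈-fibre⁻ {f = A-end} e∈v
      = e , e∈J , (λ e∈I → e∉Iv (x∈p∩q⁺ (e∈I , e∈v))) , bound
      where
      bound : ∀ a → a ∈ A → degree G (I ∪ ⁅ e ⁆) a ≤ t
      bound a a∈A with A-end e ≟ a
      ... | yes refl = begin
        ∣ (I ∪ ⁅ e ⁆) ∩ incident a ∣  ≤⟨ p⊆q⇒∣p∣≤∣q∣ at-a ⟩
        ∣ (I ∩ incident a) ∪ ⁅ e ⁆ ∣  ≤⟨ ∣p∪⁅x⁆∣≤1+∣p∣ (I ∩ incident a) e ⟩
        -- The strict inequality between the fibre counts leaves room for exactly the one edge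
        -- added.
        suc ∣ I ∩ incident a ∣        ≤⟨ subst (λ S → ∣ I ∩ S ∣ < ∣ J ∩ S ∣) (sym (incident≡fibre a∈A)) Iv<Jv ⟩
        ∣ J ∩ incident a ∣            ≤⟨ J≤t a a∈A ⟩
        t                             ∎
        where
        open ≤-Reasoning
        at-a : (I ∪ ⁅ e ⁆) ∩ incident a ⊆ (I ∩ incident a) ∪ ⁅ e ⁆
        at-a x∈ with x∈p∩q⁻ (I ∪ ⁅ e ⁆) _ x∈
        ... | x∈I∪e , x∈a with x∈p∪q⁻ I ⁅ e ⁆ x∈I∪e
        ...   | inj₁ x∈I = p⊆p∪q _ (x∈p∩q⁺ (x∈I , x∈a))
        ...   | inj₂ x∈e = q⊆p∪q (I ∩ incident a) _ x∈e
      -- At any other vertex of `A` the new edge is not incident, so no edge is gained there.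
      ... | no end≢a = ≤-trans (p⊆q⇒∣p∣≤∣q∣ away) (I≤t a a∈A)
        where
        away : (I ∪ ⁅ e ⁆) ∩ incident a ⊆ I ∩ incident a
        away x∈ with x∈p∩q⁻ (I ∪ ⁅ e ⁆) _ x∈
        ... | x∈I∪e , x∈a with x∈p∪q⁻ I ⁅ e ⁆ x∈I∪e
        ...   | inj₁ x∈I = x∈p∩q⁺ (x∈I , x∈a)
        ...   | inj₂ x∈e with refl ← x∈⁅y⁆⇒x≡y e x∈e =
          contradiction (A-end-unique (∈-incident⁻ x∈a) a∈A) end≢a

    starFree-isMatroid : ∀ t → IsMatroid (StarFree G A (suc t))
    starFree-isMatroid t = record
      -- A star with `suc t` leaves has a leaf `zero`, whose edge would lie in the empty set.
      { ∅-independent = λ a a∈A star → ∉⊥ (proj₁ (proj₂ (Star.leaf-adjacent star zero)))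
      ; hereditary    = λ J⊆I free a a∈A star → free a a∈A (star-mono J⊆I star)
      ; augmentation  = λ I-free J-free I<J →
          let e , e∈J , e∉I , bound = degree-augmentation (to I-free) (to J-free) I<J
          in  e , e∈J , e∉I , from bound
      }
      where
      -- `F` stays a parameter, so that the equivalence serves `I`, `J` and `I ∪ ⁅ e ⁆` alike.
      open module E {F} = Equivalence (starFree⇔degree≤ {A} {t} {F}) using (to; from)

mainTheorem8 : (t : ℕ) → 3 ≤ t →
    (n m : ℕ) (G : Graph n m) (A B : Subset n) → IsBipartition G A B →
    IsMatroid (StarFree G A t) ×
    (∀ F → StarFree G A t F ⇔ (∀ a → a ∈ A → degree G F a ≤ t ∸ 1))
-- The bound on `t` excludes `zero`; for a successor, `suc t ∸ 1` computes to `t`.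
mainTheorem8 (suc t) _ n m G A B bip =
  starFree-isMatroid G bip t , λ F → starFree⇔degree≤ G
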